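{- Let $\mathtt{next}:\mathtt{State}\to\mathtt{option}\ \mathtt{State}$ be a strategy. Then for every formula $f$, repeatedly applying $\mathtt{next}$ starting from the initial state $\emptyset\parallel f$ reaches, after finitely many steps, a state on which $\mathtt{next}$ returns $\mathtt{None}$; denote this state by $\mathtt{solve}(\mathtt{next})(f)$. The state $\mathtt{solve}(\mathtt{next})(f)$ is final in the classical DPLL system; if it is $\mathtt{fail}$, then $f$ is unsatisfiable, and if it is a non-$\mathtt{fail}$ state of the form $m\parallel f$, then $m$ is a model of $f$.
   Context: Fix a finite set $P$ of atoms. A literal is an atom $p\in P$ or its negation $\neg p$, with $\neg\neg p=p$. A clause is a finite list of literals, read as their disjunction; a formula (CNF) is a finite list of clauses, read as their conjunction. A partial assignment is an arbitrary finite list of literals, each annotated either as a decision literal (written $l^d$) or as a propagated literal (written $l$). New literals are appended on the right, $mn$ denotes concatenation, and $\emptyset$ is the empty list. Evaluation takes values in $\{T,F,U\}$ and ignores annotations; the rightmost occurrence of an atom takes precedence: $[\![l]\!]_m=T$ if the rightmost occurrence in $m$ of the atom of $l$ is as $l$, $F$ if it is as $\neg l$, and $U$ if the atom does not occur in $m$. For a clause $c$: $[\![c]\!]_m=T$ if some literal of $c$ evaluates to $T$, $F$ if all literals of $c$ evaluate to $F$, else $U$. For a formula $f$: $[\![f]\!]_m=T$ if all clauses evaluate to $T$, $F$ if some clause evaluates to $F$, else $U$. "True/false/undefined in $m$" means value $T/F/U$. $m$ is a model of $f$ if $[\![f]\!]_m=T$; $f$ is unsatisfiable if it has no model. A state is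 either the distinguished state $\mathtt{fail}$ or a pair $m\parallel f$ of a partial assignment and a formula. The classical DPLL system $C$ is the relation $\Longrightarrow$ on states given by the following rules (order within clauses and formulas being irrelevant for reading $c\lor l$, $f\land c$): UnitPropagate: $m\parallel f\land(c\lor l)\Longrightarrow m\,l\parallel f\land(c\lor l)$ if $c$ is false in $m$ and $l$ is undefined in $m$. Decide: $m\parallel f\Longrightarrow m\,l^d\parallel f$ if $l$ or $\neg l$ occurs in a clause of $f$ and $l$ is undefined in $m$. Fail: $m\parallel f\land c\Longrightarrow\mathtt{fail}$ if $c$ is false in $m$ and $m$ contains no decision literals. Backtrack: $m\,l^d\,n\parallel f\land c\Longrightarrow m\,\neg l\parallel f\land c$ if $c$ is false in $m\,l^d\,n$ and $n$ contains no decision literals (the new $\neg l$ is propagated). Pure: $m\parallel f\Longrightarrow m\,l\parallel f$ if $l$ occurs in a clause of $f$, $\neg l$ occurs in no clause of $f$, and $l$ is undefined in $m$. The base DPLL system $B$ consists of only the rules Decide, Fail and Backtrack. $\Longrightarrow^+$ is the transitive closure of $\Longrightarrow$ (classical system). A state $s$ is final in a system if no rule of the system applies to $s$. A function $\mathtt{next}:\mathtt{State}\to\mathtt{option}\ \mathtt{State}$ is a strategy if: (i) $\mathtt{next}\ \mathtt{fail}=\mathtt{None}$; (ii) for all states $s$, if $\mathtt{next}\ s=\mathtt{None}$ then $s$ is final in $B$; (iii) for all states $s,s'$, if $\mathtt{next}\ s=\mathtt{Some}\ s'$ then $s\Longrightarrow^+s'$. -}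

module Defs where

open import Data.Bool using (if_then_else_)
open import Data.Fin using (Fin)
import Data.Fin.Properties as Fin
open import Data.List using (List; []; _∷_; _++_; _∷ʳ_)
open import Data.List.Membership.Propositional using (_∈_)
open import Data.List.Relation.Binary.Permutation.Propositional using (_↭_)
open import Data.List.Relation.Unary.All using (All; all?)
open import Data.List.Relation.Unary.Any using (Any; any?)
open import Data.Maybe using (Maybe; just; nothing)
open import Data.Nat using (ℕ)
open import Data.Product using (∃-syntax)
open import Data.Sum using (_⊎_)
open import Level using (0ℓ)
open import Relation.Binary.Construct.Closure.ReflexiveTransitive using (Star)
open import Relation.Binary.Construct.Closure.Transitive using (TransClosure)
open import Relation.Binary.Core using (Rel)
open import Relation.Binary.Definitions using (DecidableEquality)
open import Relation.Binary.PropositionalEquality using (_≡_; refl; cong)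
open import Relation.Binary.Rewriting using (IsNormalForm)
open import Relation.Nullary using (¬_; yes; no; does)
open import Relation.Nullary.Decidable using (map′)

-- The finite set of atoms is Fin n.
data Literal (n : ℕ) : Set where
  pos neg : Fin n → Literal n

data Annotated (n : ℕ) : Set where
  decided    : Literal n → Annotated n
  propagated : Literal n → Annotated n

data Value : Set where
  T F U : Value

Clause Formula Assignment : ℕ → Set
Clause n     = List (Literal n)
Formula n    = List (Clause n)
Assignment n = List (Annotated n)

private
  variable
    n : ℕ

~_ : Literal n → Literal n
~ pos p = neg p
~ neg p = pos p

infix 9 ~_

literal : Annotated n → Literal n
literal (decided l)    = l
literal (propagated l) = l

data IsDecision {n : ℕ} : Annotated n → Set where
  isDecision : ∀ {l} → IsDecision (decided l)

NoDecisions : Assignment n → Set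
NoDecisions = All (λ a → ¬ IsDecision a)

_≟ˡ_ : DecidableEquality (Literal n)
pos p ≟ˡ pos q = map′ (cong pos) (λ { refl → refl }) (p Fin.≟ q)
pos p ≟ˡ neg q = no λ ()
neg p ≟ˡ pos q = no λ ()
neg p ≟ˡ neg q = map′ (cong neg) (λ { refl → refl }) (p Fin.≟ q)

_≟ᵛ_ : DecidableEquality Value
T ≟ᵛ T = yes refl
T ≟ᵛ F = no λ ()
T ≟ᵛ U = no λ ()
F ≟ᵛ T = no λ ()
F ≟ᵛ F = yes refl
F ≟ᵛ U = no λ ()
U ≟ᵛ T = no λ ()
U ≟ᵛ F = no λ ()
U ≟ᵛ U = yes refl

-- The head of the list is its leftmost entry, so it is consulted only when
-- the atom does not occur further to the right.
evalLiteral : Assignment n → Literal n → Value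
evalLiteral []      l = U
evalLiteral (a ∷ m) l with evalLiteral m l
... | T = T
... | F = F
... | U = if does (literal a ≟ˡ l) then T
          else if does (literal a ≟ˡ (~ l)) then F
          else U

evalClause : Assignment n → Clause n → Value
evalClause m c =
  if does (any? (λ l → evalLiteral m l ≟ᵛ T) c) then T
  else if does (all? (λ l → evalLiteral m l ≟ᵛ F) c) then F
  else U

evalFormula : Assignment n → Formula n → Value
evalFormula m f =
  if does (all? (λ c → evalClause m c ≟ᵛ T) f) then T
  else if does (any? (λ c → evalClause m c ≟ᵛ F) f) then F
  else U

IsModel : Assignment n → Formula n → Set
IsModel m f = evalFormula m f ≡ T

Unsatisfiable : Formula n → Set
Unsatisfiable f = ¬ (∃[ m ] IsModel m f)

_OccursIn_ : Literal n → Formula n → Set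
l OccursIn f = Any (l ∈_) f

infix 4 _∥_

data State (n : ℕ) : Set where
  fail : State n
  _∥_  : Assignment n → Formula n → State n

infix 3 _⟹ᴮ_ _⟹_ _⟹⁺_

-- Order being irrelevant, a formula of the form f ∧ c is a formula having c
-- as a member, and a clause of the form c ∨ l is a permutation of l ∷ c.

data _⟹ᴮ_ {n : ℕ} : Rel (State n) 0ℓ where
  decide : ∀ {m f l} →
    l OccursIn f ⊎ (~ l) OccursIn f →
    evalLiteral m l ≡ U →
    m ∥ f ⟹ᴮ (m ∷ʳ decided l) ∥ f
  failure : ∀ {m f c} →
    c ∈ f →
    evalClause m c ≡ F →
    NoDecisions m →
    m ∥ f ⟹ᴮ fail
  backtrack : ∀ {m l k f c} →
    c ∈ f →
    evalClause (m ∷ʳ decided l ++ k) c ≡ F →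
    NoDecisions k →
    (m ∷ʳ decided l ++ k) ∥ f ⟹ᴮ (m ∷ʳ propagated (~ l)) ∥ f

data _⟹_ {n : ℕ} : Rel (State n) 0ℓ where
  base : ∀ {s t} → s ⟹ᴮ t → s ⟹ t
  unitPropagate : ∀ {m f d c l} →
    d ∈ f →
    d ↭ l ∷ c →
    evalClause m c ≡ F →
    evalLiteral m l ≡ U →
    m ∥ f ⟹ (m ∷ʳ propagated l) ∥ f
  pure : ∀ {m f l} →
    l OccursIn f →
    ¬ ((~ l) OccursIn f) →
    evalLiteral m l ≡ U →
    m ∥ f ⟹ (m ∷ʳ propagated l) ∥ f

_⟹⁺_ : Rel (State n) 0ℓ
_⟹⁺_ = TransClosure _⟹_

Final : Rel (State n) 0ℓ → State n → Set
Final = IsNormalForm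

record IsStrategy (next : State n → Maybe (State n)) : Set where
  field
    next-fail    : next fail ≡ nothing
    next-nothing : ∀ s → next s ≡ nothing → Final _⟹ᴮ_ s
    next-just    : ∀ s t → next s ≡ just t → s ⟹⁺ t

-- solve(next)(f) is rendered as the graph of a function: s is reached from
-- [] ∥ f by finitely many applications of next, and next stops at s.
-- There is at most one such s; that there is one has to be proved.
record Solves (next : State n → Maybe (State n)) (f : Formula n) (s : State n) : Set where
  field
    reached : Star (λ t u → next t ≡ just u) ([] ∥ f) s
    stopped : next s ≡ nothing

{-# OPTIONS --safe #-}
module Submission where

-- Along a run from the initial state, the atoms of the assignment stay
-- pairwise distinct, and appending a propagated literal to the entries before
-- it never destroys satisfiability: if some model of the formula makes the
-- prefix true, then so does some model also making the propagated literal true.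
-- The pure literal rule only preserves satisfiability, so the stronger claim
-- that propagated literals are entailed by the prefix would fail. At a conflict
-- without decisions the invariant refutes the formula. Distinctness bounds the
-- length of assignments by n, so reading a position as a ternary digit (absent 2,
-- decided 1, propagated 0, most significant digit leftmost) makes every rule
-- strictly decrease a natural number.

open import Defs
open import Data.Bool using (Bool; true; false; not; if_then_else_)
open import Data.Fin using (Fin; zero; suc)
import Data.Fin.Properties as Fin
open import Data.List using (List; []; _∷_; _++_; _∷ʳ_; map; length; lookup; initLast; _∷ʳ′_)
open import Data.List.Membership.Propositional using (_∈_; find; lose)
open import Data.List.Membership.Propositional.Properties using (∈-lookup)
open import Data.List.Properties
  using (++-assoc; ++-identityʳ; ∷ʳ-injective; ∷ʳ-injectiveˡ; ∷ʳ-++; map-++; length-map; length-++)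
open import Data.List.Relation.Binary.Permutation.Propositional using (_↭_; ↭-sym)
open import Data.List.Relation.Binary.Permutation.Propositional.Properties using (Any-resp-↭; ∈-resp-↭)
open import Data.List.Relation.Unary.All as All using (All; []; _∷_; all?)
open import Data.List.Relation.Unary.All.Properties using (++⁺; ++⁻ˡ; map⁺; ¬Any⇒All¬; All¬⇒¬Any)
open import Data.List.Relation.Unary.AllPairs using ([]; _∷_)
import Data.List.Relation.Unary.AllPairs.Properties as AllPairs
open import Data.List.Relation.Unary.Any as Any using (Any; here; there; any?)
open import Data.List.Relation.Unary.Unique.Propositional using (Unique)
open import Data.Maybe using (Maybe; just; nothing)
open import Data.Nat using (ℕ; zero; suc; _+_; _^_; _≤_; _<_; z<s; s<s)
open import Data.Nat.Induction using (<-wellFounded)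
open import Data.Nat.Properties
  using (≤-trans; <-trans; m≤m+n; m≤n+m; m<m+n; +-comm; +-monoʳ-<; m^n>0)
open import Data.Product using (∃-syntax; _×_; _,_)
open import Data.Sum using (_⊎_; inj₁; inj₂)
open import Function using (_∘_)
open import Induction.WellFounded using (Acc; acc)
open import Relation.Binary.Construct.Closure.ReflexiveTransitive using (Star; ε; _◅_)
open import Relation.Binary.Construct.Closure.Transitive using ([_]; _∷_)
open import Relation.Binary.PropositionalEquality
  using (_≡_; _≢_; refl; sym; trans; cong; subst)
open import Relation.Nullary using (¬_; yes; no; does; contradiction)

private
  variable
    n : ℕ

-- Literals

atom : Literal n → Fin n
atom (pos p) = p
atom (neg p) = p

isPositive : Literal n → Bool
isPositive (pos _) = true
isPositive (neg _) = false

~-involutive : (l : Literal n) → ~ ~ l ≡ l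
~-involutive (pos _) = refl
~-involutive (neg _) = refl

l≢~l : (l : Literal n) → l ≢ ~ l
l≢~l (pos _) ()
l≢~l (neg _) ()

atom-~ : (l : Literal n) → atom (~ l) ≡ atom l
atom-~ (pos _) = refl
atom-~ (neg _) = refl

atom-injective-upto-~ : (k l : Literal n) → atom k ≡ atom l → k ≡ l ⊎ k ≡ ~ l
atom-injective-upto-~ (pos _) (pos _) eq = inj₁ (cong pos eq)
atom-injective-upto-~ (pos _) (neg _) eq = inj₂ (cong pos eq)
atom-injective-upto-~ (neg _) (pos _) eq = inj₂ (cong neg eq)
atom-injective-upto-~ (neg _) (neg _) eq = inj₁ (cong neg eq)

-- Valuations

Valuation : ℕ → Set
Valuation n = Fin n → Bool

value : Valuation n → Literal n → Bool
value v (pos p) = v p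
value v (neg p) = not (v p)

infix 4 _⊨_

_⊨_ : Valuation n → Literal n → Set
v ⊨ l = value v l ≡ true

value-~ : (v : Valuation n) (l : Literal n) → value v (~ l) ≡ not (value v l)
value-~ v (pos p) = refl
value-~ v (neg p) with v p
... | true  = refl
... | false = refl

⊨-~-disjoint : ∀ (v : Valuation n) l → v ⊨ l → ¬ (v ⊨ ~ l)
⊨-~-disjoint v l v⊨l v⊨~l with trans (sym v⊨~l) (trans (value-~ v l) (cong not v⊨l))
... | ()

⊨-or-~ : ∀ (v : Valuation n) l → v ⊨ l ⊎ v ⊨ ~ l
⊨-or-~ v l with value v l in eq
... | true  = inj₁ refl
... | false = inj₂ (trans (value-~ v l) (cong not eq))

assign : Literal n → Valuation n → Valuation n
assign l v p = if does (p Fin.≟ atom l) then isPositive l else v p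

assign-⊨ : ∀ (l : Literal n) v → assign l v ⊨ l
assign-⊨ (pos p) v with p Fin.≟ p
... | yes _  = refl
... | no p≢p = contradiction refl p≢p
assign-⊨ (neg p) v with p Fin.≟ p
... | yes _  = refl
... | no p≢p = contradiction refl p≢p

value-assign-≢ : ∀ (l : Literal n) v k → atom k ≢ atom l → value (assign l v) k ≡ value v k
value-assign-≢ l v (pos p) p≢l with p Fin.≟ atom l
... | yes p≡l = contradiction p≡l p≢l
... | no _    = refl
value-assign-≢ l v (neg p) p≢l with p Fin.≟ atom l
... | yes p≡l = contradiction p≡l p≢l
... | no _    = refl

assign-preserves-⊨ : ∀ (l : Literal n) v k → k ≢ ~ l → v ⊨ k → assign l v ⊨ k
assign-preserves-⊨ l v k k≢~l v⊨k with atom k Fin.≟ atom l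
... | no k≢l = trans (value-assign-≢ l v k k≢l) v⊨k
... | yes k≡l with atom-injective-upto-~ k l k≡l
...   | inj₁ refl = assign-⊨ l v
...   | inj₂ k≡~l = contradiction k≡~l k≢~l

-- Evaluation

evalLiteral-T⇒⊨ : ∀ {v : Valuation n} {m l} → All ((v ⊨_) ∘ literal) m →
                  evalLiteral m l ≡ T → v ⊨ l
evalLiteral-F⇒⊨~ : ∀ {v : Valuation n} {m l} → All ((v ⊨_) ∘ literal) m →
                   evalLiteral m l ≡ F → v ⊨ ~ l

evalLiteral-T⇒⊨ {m = a ∷ m} {l} (v⊨a ∷ v⊨m) eq with evalLiteral m l in eqₘ
... | T = evalLiteral-T⇒⊨ v⊨m eqₘ
... | U with literal a ≟ˡ l
...   | yes refl = v⊨a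
...   | no _ with literal a ≟ˡ (~ l)
evalLiteral-T⇒⊨ {m = a ∷ m} {l} (v⊨a ∷ v⊨m) () | U | no _ | yes _
evalLiteral-T⇒⊨ {m = a ∷ m} {l} (v⊨a ∷ v⊨m) () | U | no _ | no _

evalLiteral-F⇒⊨~ {m = a ∷ m} {l} (v⊨a ∷ v⊨m) eq with evalLiteral m l in eqₘ
... | F = evalLiteral-F⇒⊨~ v⊨m eqₘ
... | U with literal a ≟ˡ l
evalLiteral-F⇒⊨~ {m = a ∷ m} {l} (v⊨a ∷ v⊨m) () | U | yes _
...   | no _ with literal a ≟ˡ (~ l)
...     | yes a≡~l = subst (_ ⊨_) a≡~l v⊨a

evalLiteral-U⇒fresh : ∀ {m : Assignment n} {l} → evalLiteral m l ≡ U →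
                      All (λ a → atom (literal a) ≢ atom l) m
evalLiteral-U⇒fresh {m = []} eq = []
evalLiteral-U⇒fresh {m = a ∷ m} {l} eq with evalLiteral m l in eqₘ
... | U with literal a ≟ˡ l
evalLiteral-U⇒fresh {m = a ∷ m} {l} () | U | yes _
...   | no a≢l with literal a ≟ˡ (~ l)
...     | no a≢~l = distinct ∷ evalLiteral-U⇒fresh eqₘ
  where
  distinct : atom (literal a) ≢ atom l
  distinct eq′ with atom-injective-upto-~ (literal a) l eq′
  ... | inj₁ a≡l  = a≢l a≡l
  ... | inj₂ a≡~l = a≢~l a≡~l

negate : Value → Value
negate T = F
negate F = T
negate U = U

evalLiteral-~ : ∀ (m : Assignment n) l → evalLiteral m (~ l) ≡ negate (evalLiteral m l)
evalLiteral-~ []      l = refl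
evalLiteral-~ (a ∷ m) l rewrite evalLiteral-~ m l with evalLiteral m l
... | T = refl
... | F = refl
-- Once `~ ~ l` is reduced to `l`, evaluating `~ l` makes the same two comparisons as evaluating
-- `l`, in the opposite order. The order could matter only if both succeeded.
... | U rewrite ~-involutive l with literal a ≟ˡ l | literal a ≟ˡ (~ l)
...   | yes a≡l | yes a≡~l = contradiction (trans (sym a≡l) a≡~l) (l≢~l l)
...   | yes _   | no _     = refl
...   | no _    | yes _    = refl
...   | no _    | no _     = refl

evalClause-T⇒Any : ∀ (m : Assignment n) c → evalClause m c ≡ T →
                   Any (λ l → evalLiteral m l ≡ T) c
evalClause-T⇒Any m c eq with any? (λ l → evalLiteral m l ≟ᵛ T) c
... | yes some = some
... | no _ with all? (λ l → evalLiteral m l ≟ᵛ F) c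
evalClause-T⇒Any m c () | no _ | yes _
evalClause-T⇒Any m c () | no _ | no _

evalClause-F⇒All : ∀ (m : Assignment n) c → evalClause m c ≡ F →
                   All (λ l → evalLiteral m l ≡ F) c
evalClause-F⇒All m c eq with any? (λ l → evalLiteral m l ≟ᵛ T) c
evalClause-F⇒All m c () | yes _
... | no _ with all? (λ l → evalLiteral m l ≟ᵛ F) c
...   | yes every = every

evalFormula-T⇒All : ∀ (m : Assignment n) f → evalFormula m f ≡ T →
                    All (λ c → evalClause m c ≡ T) f
evalFormula-T⇒All m f eq with all? (λ c → evalClause m c ≟ᵛ T) f
... | yes every = every
... | no _ with any? (λ c → evalClause m c ≟ᵛ F) f
evalFormula-T⇒All m f () | no _ | yes _
evalFormula-T⇒All m f () | no _ | no _

All⇒evalFormula-T : ∀ (m : Assignment n) f → All (λ c → evalClause m c ≡ T) f →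
                    evalFormula m f ≡ T
All⇒evalFormula-T m f every with all? (λ c → evalClause m c ≟ᵛ T) f
... | yes _     = refl
... | no ¬every = contradiction every ¬every

evalClause-total : ∀ (m : Assignment n) c → All (λ l → evalLiteral m l ≢ U) c →
                   evalClause m c ≢ F → evalClause m c ≡ T
evalClause-total m c defined c≢F with any? (λ l → evalLiteral m l ≟ᵛ T) c
... | yes _ = refl
... | no ¬some with all? (λ l → evalLiteral m l ≟ᵛ F) c
...   | yes _     = contradiction refl c≢F
...   | no ¬every = contradiction (All.zipWith notT⇒F (defined , ¬Any⇒All¬ c ¬some)) ¬every
  where
  notT⇒F : ∀ {l} → evalLiteral m l ≢ U × evalLiteral m l ≢ T → evalLiteral m l ≡ F
  notT⇒F {l} (≢U , ≢T) with evalLiteral m l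
  ... | T = contradiction refl ≢T
  ... | F = refl
  ... | U = contradiction refl ≢U

-- Satisfiability

-- Witnesses are total valuations, so that each literal or its negation is true and a single atom
-- can be reassigned. With `[]` this is plain satisfiability of `f`.
Satisfiable : Formula n → Assignment n → Set
Satisfiable f m = ∃[ v ] (All ((v ⊨_) ∘ literal) m × All (Any (v ⊨_)) f)

conflict⇒¬Satisfiable : ∀ {f : Formula n} {m c} → c ∈ f → evalClause m c ≡ F → ¬ Satisfiable f m
conflict⇒¬Satisfiable {m = m} {c} c∈f c≡F (v , v⊨m , v⊨f) =
  All¬⇒¬Any (All.map (λ {l} l≡F v⊨l → ⊨-~-disjoint v l v⊨l (evalLiteral-F⇒⊨~ v⊨m l≡F))
                     (evalClause-F⇒All m c c≡F))
            (All.lookup v⊨f c∈f)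

-- Atoms undefined in `m` default to false. This is harmless, since only the literals true in `m`
-- have to stay true.
valuation : Assignment n → Valuation n
valuation m p = does (evalLiteral m (pos p) ≟ᵛ T)

evalLiteral-T⇒valuation⊨ : ∀ (m : Assignment n) l → evalLiteral m l ≡ T → valuation m ⊨ l
evalLiteral-T⇒valuation⊨ m (pos p) eq rewrite eq = refl
evalLiteral-T⇒valuation⊨ m (neg p) eq rewrite evalLiteral-~ m (neg p) | eq = refl

model⇒Satisfiable : ∀ {f : Formula n} {m} → IsModel m f → Satisfiable f []
model⇒Satisfiable {f = f} {m} m⊨f =
  valuation m , [] ,
  All.map (λ {c} c≡T → Any.map (λ {l} → evalLiteral-T⇒valuation⊨ m l) (evalClause-T⇒Any m c c≡T))
          (evalFormula-T⇒All m f m⊨f)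

unit-Satisfiable : ∀ {f : Formula n} {m d c l} → d ∈ f → d ↭ l ∷ c → evalClause m c ≡ F →
                   Satisfiable f m → Satisfiable f (m ∷ʳ propagated l)
unit-Satisfiable {m = m} {c = c} {l} d∈f d↭l∷c c≡F (v , v⊨m , v⊨f) =
  v , ++⁺ v⊨m (v⊨l ∷ []) , v⊨f
  where
  v⊨l : v ⊨ l
  v⊨l with Any-resp-↭ d↭l∷c (All.lookup v⊨f d∈f)
  ... | here v⊨l  = v⊨l
  -- If `v` satisfied `c`, it would witness satisfiability of the one-clause formula `c ∷ []` under
  -- `m`, where `c` is a conflict.
  ... | there v⊨c =
    contradiction (v , v⊨m , v⊨c ∷ []) (conflict⇒¬Satisfiable (here refl) c≡F)

-- The witness may have to change: `l` is forced to true. The entries of `m` have other atoms and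
-- keep their values; the only literal that can lose truth is `~ l`, which no clause contains.
pure-Satisfiable : ∀ {f : Formula n} {m l} → ¬ ((~ l) OccursIn f) → evalLiteral m l ≡ U →
                   Satisfiable f m → Satisfiable f (m ∷ʳ propagated l)
pure-Satisfiable {f = f} {m} {l} ~l∉f l≡U (v , v⊨m , v⊨f) =
  assign l v , ++⁺ assign⊨m (assign-⊨ l v ∷ []) , All.tabulate assign⊨f
  where
  assign⊨m : All ((assign l v ⊨_) ∘ literal) m
  assign⊨m = All.zipWith
    (λ {a} (a≢l , v⊨a) → trans (value-assign-≢ l v (literal a) a≢l) v⊨a)
    (evalLiteral-U⇒fresh l≡U , v⊨m)

  assign⊨f : ∀ {c} → c ∈ f → Any (assign l v ⊨_) c
  assign⊨f c∈f with find (All.lookup v⊨f c∈f)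
  ... | k , k∈c , v⊨k =
    lose k∈c (assign-preserves-⊨ l v k (λ { refl → ~l∉f (lose c∈f k∈c) }) v⊨k)

flip-Satisfiable : ∀ {f : Formula n} {m l} → ¬ Satisfiable f (m ∷ʳ decided l) →
                   Satisfiable f m → Satisfiable f (m ∷ʳ propagated (~ l))
flip-Satisfiable {l = l} unsat (v , v⊨m , v⊨f) with ⊨-or-~ v l
... | inj₁ v⊨l  = contradiction (v , ++⁺ v⊨m (v⊨l ∷ []) , v⊨f) unsat
... | inj₂ v⊨~l = v , ++⁺ v⊨m (v⊨~l ∷ []) , v⊨f

-- Soundness of propagated literals

-- The condition on a propagated literal ignores the remainder `k` to its right, so it passes to
-- prefixes, as backtracking requires.
Sound : Formula n → Assignment n → Set
Sound f m = ∀ {p l k} → m ≡ p ∷ʳ propagated l ++ k →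
            Satisfiable f p → Satisfiable f (p ∷ʳ propagated l)

sound-[] : ∀ {f : Formula n} → Sound f []
sound-[] {p = []}    ()
sound-[] {p = _ ∷ _} ()

sound-++⁻ˡ : ∀ {f : Formula n} m {k} → Sound f (m ++ k) → Sound f m
sound-++⁻ˡ m {k} sound {p} {l} {k′} eq =
  sound (trans (cong (_++ k) eq) (++-assoc (p ∷ʳ propagated l) k′ k))

sound-∷ʳ : ∀ {f : Formula n} {m a} → Sound f m →
           (∀ {l} → a ≡ propagated l → Satisfiable f m → Satisfiable f (m ∷ʳ propagated l)) →
           Sound f (m ∷ʳ a)
-- Either the propagated literal is the new last entry, or `k` ends in that entry and dropping it
-- leaves a splitting of `m`.
sound-∷ʳ {m = m} sound last {p} {l} {k} eq with initLast k
... | [] with ∷ʳ-injective m p (trans eq (++-identityʳ _))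
...   | refl , a≡l = last a≡l
sound-∷ʳ {m = m} sound last {p} {l} eq | ks ∷ʳ′ x =
  sound (∷ʳ-injectiveˡ m _ (trans eq (sym (++-assoc (p ∷ʳ propagated l) ks (x ∷ [])))))

-- Every entry of `k` is propagated, so soundness applies to them one after another, each moving
-- from `k` to the end of `m`.
sound-noDecisions : ∀ {f : Formula n} m {k} → Sound f (m ++ k) → NoDecisions k →
                    Satisfiable f m → Satisfiable f (m ++ k)
sound-noDecisions {f = f} m {[]} _ _ sat = subst (Satisfiable f) (sym (++-identityʳ m)) sat
sound-noDecisions m {decided _ ∷ k} _ (¬d ∷ _) _ = contradiction isDecision ¬d
sound-noDecisions {f = f} m {propagated l ∷ k} sound (_ ∷ none) sat =
  subst (Satisfiable f) (∷ʳ-++ m _ k)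
    (sound-noDecisions (m ∷ʳ propagated l) (subst (Sound f) (sym (∷ʳ-++ m _ k)) sound) none
      (sound (sym (∷ʳ-++ m _ k)) sat))

-- Distinctness of atoms

atoms : Assignment n → List (Fin n)
atoms = map (atom ∘ literal)

unique-∷ʳ : ∀ {m : Assignment n} {a} → Unique (atoms m) → evalLiteral m (literal a) ≡ U →
            Unique (atoms (m ∷ʳ a))
unique-∷ʳ {m = m} {a} unique a≡U =
  subst Unique (sym (map-++ _ m (a ∷ [])))
    (AllPairs.++⁺ unique ([] ∷ []) (map⁺ (All.map (_∷ []) (evalLiteral-U⇒fresh a≡U))))

unique-++⁻ˡ : ∀ {A : Set} (xs : List A) {ys} → Unique (xs ++ ys) → Unique xs
unique-++⁻ˡ []       _              = []
unique-++⁻ˡ (x ∷ xs) (x∉ ∷ unique) = ++⁻ˡ xs x∉ ∷ unique-++⁻ˡ xs unique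

unique-atoms-++⁻ˡ : ∀ (m : Assignment n) {k} → Unique (atoms (m ++ k)) → Unique (atoms m)
unique-atoms-++⁻ˡ m {k} unique = unique-++⁻ˡ (atoms m) (subst Unique (map-++ _ m k) unique)

lookup-injective : ∀ {A : Set} {xs : List A} → Unique xs →
                   ∀ {i j} → lookup xs i ≡ lookup xs j → i ≡ j
lookup-injective (_  ∷ _)      {zero}  {zero}  _  = refl
lookup-injective (x∉ ∷ _)      {zero}  {suc j} eq = contradiction eq (All.lookup x∉ (∈-lookup j))
lookup-injective (x∉ ∷ _)      {suc i} {zero}  eq =
  contradiction (sym eq) (All.lookup x∉ (∈-lookup i))
lookup-injective (_  ∷ unique) {suc i} {suc j} eq = cong suc (lookup-injective unique eq)

-- Pigeonhole: looking up atoms by position is an injection into `Fin n`.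
unique⇒length≤ : ∀ {m : Assignment n} → Unique (atoms m) → length m ≤ n
unique⇒length≤ {m = m} unique =
  subst (_≤ _) (length-map _ m) (Fin.injective⇒≤ (lookup-injective unique))

unique-∷ʳ⇒length< : ∀ {m : Assignment n} {a} → Unique (atoms (m ∷ʳ a)) → length m < n
unique-∷ʳ⇒length< {m = m} {a} unique =
  subst (_≤ _) (trans (length-++ m) (+-comm (length m) 1)) (unique⇒length≤ unique)

-- The ternary weight

-- The ternary number plus one, with `i` the number of digits left: `i` absent digits read as 3 ^ i
-- - 1. The extra one keeps the weight positive, leaving 0 for `fail`.
weight : ℕ → Assignment n → ℕ
weight zero    _                  = 1
weight (suc i) []                 = 3 ^ suc i
weight (suc i) (decided _ ∷ m)    = 3 ^ i + weight i m
weight (suc i) (propagated _ ∷ m) = weight i m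

weight>0 : ∀ i (m : Assignment n) → 0 < weight i m
weight>0 zero    _                  = z<s
weight>0 (suc i) []                 = m^n>0 3 (suc i)
weight>0 (suc i) (decided _ ∷ m)    = ≤-trans (weight>0 i m) (m≤n+m _ (3 ^ i))
weight>0 (suc i) (propagated _ ∷ m) = weight>0 i m

weight-[] : ∀ {n} i → weight {n} i [] ≡ 3 ^ i
weight-[] zero    = refl
weight-[] (suc _) = refl

-- The digit after `m` drops from 2 to 1 or 0 and no other digit changes; `length m < i` ensures
-- that this digit exists.
weight-∷ʳ : ∀ {i} (m : Assignment n) a → length m < i → weight i (m ∷ʳ a) < weight i m
weight-∷ʳ {n} {suc i} [] (decided _) _ rewrite weight-[] {n} i =
  +-monoʳ-< (3 ^ i) (m<m+n (3 ^ i) (≤-trans (m^n>0 3 i) (m≤m+n _ _)))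
weight-∷ʳ {n} {suc i} [] (propagated _) _ rewrite weight-[] {n} i =
  m<m+n (3 ^ i) (≤-trans (m^n>0 3 i) (m≤m+n _ _))
weight-∷ʳ {i = suc i} (decided _ ∷ m)    a (s<s m<i) = +-monoʳ-< (3 ^ i) (weight-∷ʳ m a m<i)
weight-∷ʳ {i = suc i} (propagated _ ∷ m) a (s<s m<i) = weight-∷ʳ m a m<i

-- The digit after `m` drops from 1 to 0, which outweighs resetting all digits of `k` to 2.
weight-backtrack : ∀ {i} (m : Assignment n) l l′ k → length m < i →
                   weight i (m ∷ʳ propagated l′) < weight i (m ∷ʳ decided l ++ k)
weight-backtrack {n} {suc i} [] l l′ k _ rewrite weight-[] {n} i = m<m+n (3 ^ i) (weight>0 i k)
weight-backtrack {i = suc i} (decided _ ∷ m)    l l′ k (s<s m<i) =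
  +-monoʳ-< (3 ^ i) (weight-backtrack m l l′ k m<i)
weight-backtrack {i = suc i} (propagated _ ∷ m) l l′ k (s<s m<i) = weight-backtrack m l l′ k m<i

measure : State n → ℕ
measure fail        = 0
measure {n} (m ∥ _) = weight n m

-- Invariance and termination

-- The initial formula is a parameter because `fail` carries no formula of its own.
Invariant : Formula n → State n → Set
Invariant f fail    = ¬ Satisfiable f []
Invariant f (m ∥ g) = g ≡ f × Unique (atoms m) × Sound f m

extend : ∀ {f : Formula n} {m a} → Unique (atoms m) → evalLiteral m (literal a) ≡ U → Sound f m →
         (∀ {l} → a ≡ propagated l → Satisfiable f m → Satisfiable f (m ∷ʳ propagated l)) →
         Invariant f ((m ∷ʳ a) ∥ f) × measure ((m ∷ʳ a) ∥ f) < measure (m ∥ f)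
extend {m = m} {a} unique a≡U sound last =
  (refl , unique′ , sound-∷ʳ sound last) , weight-∷ʳ m a (unique-∷ʳ⇒length< unique′)
  where unique′ = unique-∷ʳ unique a≡U

⟹-step : ∀ {f : Formula n} {s t} → Invariant f s → s ⟹ t → Invariant f t × measure t < measure s
⟹-step (refl , unique , sound) (base (decide _ l≡U)) = extend unique l≡U sound (λ ())
-- With no decisions at all, satisfiability of `f` would travel from `[]` along the whole assignment
-- to the conflict.
⟹-step {n} (refl , _ , sound) (base (failure {m} c∈f c≡F none)) =
  conflict⇒¬Satisfiable c∈f c≡F ∘ sound-noDecisions [] sound none , weight>0 n m
⟹-step {f = f} (refl , unique , sound) (base (backtrack {m} {l} {k} c∈f c≡F none)) =
  (refl , unique-flip , sound-∷ʳ (sound-++⁻ˡ m sound-m) λ { refl → flip-Satisfiable refuted }) ,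
  weight-backtrack m l (~ l) k (unique-∷ʳ⇒length< unique-l)
  where
  unique-l : Unique (atoms (m ∷ʳ decided l))
  unique-l = unique-atoms-++⁻ˡ (m ∷ʳ decided l) unique

  unique-flip : Unique (atoms (m ∷ʳ propagated (~ l)))
  unique-flip = subst Unique
    (trans (map-++ _ m _) (trans (cong (λ p → atoms m ∷ʳ p) (sym (atom-~ l))) (sym (map-++ _ m _))))
    unique-l

  sound-m : Sound f (m ∷ʳ decided l)
  sound-m = sound-++⁻ˡ (m ∷ʳ decided l) sound

  -- `k` has no decisions, so the conflict at its end is pulled back to the decision itself.
  refuted : ¬ Satisfiable f (m ∷ʳ decided l)
  refuted = conflict⇒¬Satisfiable c∈f c≡F ∘ sound-noDecisions (m ∷ʳ decided l) sound none
⟹-step (refl , unique , sound) (unitPropagate d∈f d↭l∷c c≡F l≡U) =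
  extend unique l≡U sound λ { refl → unit-Satisfiable d∈f d↭l∷c c≡F }
⟹-step (refl , unique , sound) (pure _ ~l∉f l≡U) =
  extend unique l≡U sound λ { refl → pure-Satisfiable ~l∉f l≡U }

⟹⁺-step : ∀ {f : Formula n} {s t} → Invariant f s → s ⟹⁺ t → Invariant f t × measure t < measure s
⟹⁺-step inv [ s⟹t ] = ⟹-step inv s⟹t
⟹⁺-step inv (s⟹t ∷ t⟹⁺u) with ⟹-step inv s⟹t
... | inv′ , t<s with ⟹⁺-step inv′ t⟹⁺u
...   | inv″ , u<t = inv″ , <-trans u<t t<s

-- An answer of `next` stands for at least one rule step, so the measure strictly decreases at each
-- call.
run : ∀ {next : State n → Maybe (State n)} → IsStrategy next → ∀ {f} s → Invariant f s →
      Acc _<_ (measure s) →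
      ∃[ t ] (Star (λ u u′ → next u ≡ just u′) s t × next t ≡ nothing × Invariant f t)
run {next = next} strategy s inv (acc rec) with next s in eq
... | nothing = s , ε , eq , inv
... | just s′ with ⟹⁺-step inv (IsStrategy.next-just strategy s s′ eq)
...   | inv′ , s′<s with run strategy s′ inv′ (rec s′<s)
...     | t , path , stop , inv″ = t , eq ◅ path , stop , inv″

-- Final states

finalᴮ⇒defined : ∀ {m : Assignment n} {f l} → Final _⟹ᴮ_ (m ∥ f) → l OccursIn f → evalLiteral m l ≢ U
finalᴮ⇒defined final l∈f l≡U = final (_ , decide (inj₁ l∈f) l≡U)

-- The two additional rules need an undefined literal occurring in the formula, and there `decide`
-- applies already.
finalᴮ⇒final : ∀ {s : State n} → Final _⟹ᴮ_ s → Final _⟹_ s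
finalᴮ⇒final final (_ , base s⟹t)                 = final (_ , s⟹t)
finalᴮ⇒final final (_ , unitPropagate d∈f d↭l∷c _ l≡U) =
  finalᴮ⇒defined final (lose d∈f (∈-resp-↭ (↭-sym d↭l∷c) (here refl))) l≡U
finalᴮ⇒final final (_ , pure l∈f _ l≡U)           = finalᴮ⇒defined final l∈f l≡U

lastDecision : (m : Assignment n) →
  NoDecisions m ⊎ ∃[ p ] ∃[ l ] ∃[ k ] (m ≡ p ∷ʳ decided l ++ k × NoDecisions k)
lastDecision [] = inj₁ []
lastDecision (a ∷ m) with lastDecision m
lastDecision (a            ∷ m) | inj₂ (p , l , k , refl , none) = inj₂ (a ∷ p , l , k , refl , none)
lastDecision (decided l    ∷ m) | inj₁ none = inj₂ ([] , l , m , refl , none)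
lastDecision (propagated _ ∷ m) | inj₁ none = inj₁ ((λ ()) ∷ none)

-- Without decisions `failure` applies; otherwise `backtrack` applies at the rightmost one.
conflict⇒reducible : ∀ {m : Assignment n} {f c} → c ∈ f → evalClause m c ≡ F → ∃[ t ] (m ∥ f ⟹ᴮ t)
conflict⇒reducible {m = m} c∈f c≡F with lastDecision m
... | inj₁ none                        = _ , failure c∈f c≡F none
... | inj₂ (p , l , k , refl , none) = _ , backtrack {m = p} c∈f c≡F none

-- As `decide` is blocked, every literal of `f` is defined; as conflicts are reducible, no clause is
-- false. Hence each clause is true.
finalᴮ⇒model : ∀ {m : Assignment n} {f} → Final _⟹ᴮ_ (m ∥ f) → IsModel m f
finalᴮ⇒model {m = m} {f} final = All⇒evalFormula-T m f (All.tabulate clause-T)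
  where
  clause-T : ∀ {c} → c ∈ f → evalClause m c ≡ T
  clause-T {c} c∈f = evalClause-total m c
    (All.tabulate λ l∈c → finalᴮ⇒defined final (lose c∈f l∈c))
    (λ c≡F → final (conflict⇒reducible c∈f c≡F))

mainTheorem5 : ∀ (n : ℕ) (next : State n → Maybe (State n)) → IsStrategy next →
    ∀ (f : Formula n) →
    ∃[ s ] (Solves next f s
    × Final _⟹_ s
    × (s ≡ fail → Unsatisfiable f)
    × (s ≢ fail → ∃[ m ] (s ≡ (m ∥ f) × IsModel m f)))
mainTheorem5 n next strategy f
  with run strategy ([] ∥ f) (refl , [] , sound-[]) (<-wellFounded _)
... | s , path , stop , inv =
  s , record { reached = path ; stopped = stop } , finalᴮ⇒final final , refuted s inv , satisfied s inv final
  where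
  final : Final _⟹ᴮ_ s
  final = IsStrategy.next-nothing strategy s stop

  refuted : ∀ s → Invariant f s → s ≡ fail → Unsatisfiable f
  refuted fail unsat refl (m , m⊨f) = unsat (model⇒Satisfiable {m = m} m⊨f)

  satisfied : ∀ s → Invariant f s → Final _⟹ᴮ_ s → s ≢ fail → ∃[ m ] (s ≡ (m ∥ f) × IsModel m f)
  satisfied fail    _              _     ≢fail = contradiction refl ≢fail
  satisfied (m ∥ _) (refl , _ , _) final _     = m , refl , finalᴮ⇒model final
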